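{- For all $L\in\mathbf N$ and $a\in\mathbb Z$, $$\sum_{k\geq0} C_{L,k}(q)\begin{bmatrix} k\\ \left\lfloor\frac{k-a}{2}\right\rfloor\end{bmatrix}_q=q^{T(a)}\begin{bmatrix} 2L+1\\ L-a\end{bmatrix}_q,$$ where $$C_{L,k}(q)=\sum_{m=0}^L q^{T(m)+T(m+k)}\begin{bmatrix} L\\ m,k\end{bmatrix}_q .$$
   Context: $\mathbf N$ denotes the set of nonnegative integers. For $m\in\mathbf N$, $(q)_m=\prod_{j=1}^m(1-q^j)$, with $(q)_0=1$. The $q$-binomial coefficient is $\begin{bmatrix} m+n\\ m\end{bmatrix}_q=\frac{(q)_{m+n}}{(q)_m(q)_n}$ if $m,n\in\mathbf N$, and it is $0$ otherwise (so $\begin{bmatrix} A\\ B\end{bmatrix}_q=0$ unless $0\le B\le A$). For $j\in\mathbb Z$, $T(j)=\binom{j+1}{2}=\frac{j(j+1)}{2}$. Moreover $\begin{bmatrix} L\\ m,k\end{bmatrix}_q=\begin{bmatrix} L\\ m\end{bmatrix}_q\begin{bmatrix} L-m\\ k\end{bmatrix}_q$. -}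

module Defs where

open import Algebra.Bundles using (RawMonoid)
import Algebra.Definitions.RawMonoid as RawMonoidDefs
open import Data.Bool using (if_then_else_)
open import Data.Fin using (toℕ)
open import Data.Integer as ℤ using (ℤ; +_; -[1+_]; 0ℤ; 1ℤ; ∣_∣; _/ℕ_)
open import Data.Integer.Properties as ℤₚ using (+-0-abelianGroup)
open import Data.Nat as ℕ using (ℕ; zero; suc; _∸_; _≡ᵇ_)
open import Data.Product using (∃-syntax; _×_)
open import Level using (0ℓ)
open import Relation.Binary.PropositionalEquality
  using (_≡_; _≗_; refl; sym; trans; cong; cong₂; module ≡-Reasoning)
open import Algebra.Properties.AbelianGroup +-0-abelianGroup using (xyx⁻¹≈y)

private module ℤ∑ = RawMonoidDefs ℤ.+-0-rawMonoid

-- The indeterminate q is formal: identities are read in ℤ⟦q⟧, which contains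
-- ℤ[q] and in which every (q)_m is invertible.  A series is its sequence of
-- coefficients, and equality is equality of all coefficients.
Series : Set
Series = ℕ → ℤ

infix  4 _≈_
infixl 6 _+_ _-_
infixl 7 _*_ _÷_
infix  8 q^_

_≈_ : Series → Series → Set
_≈_ = _≗_

0# 1# : Series
0# _ = 0ℤ
1# zero    = 1ℤ
1# (suc _) = 0ℤ

q^_ : ℕ → Series
(q^ n) i = if i ≡ᵇ n then 1ℤ else 0ℤ

_+_ _-_ _*_ : Series → Series → Series
(f + g) n = f n ℤ.+ g n
(f - g) n = f n ℤ.- g n
(f * g) n = ℤ∑.sum {suc n} λ i → f (toℕ i) ℤ.* g (n ∸ toℕ i)

-- Long division in ascending powers of q, for a divisor with constant
-- coefficient 1; the value is meaningless for other divisors.  See ÷-*.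
_÷_ : Series → Series → Series
(f ÷ g) zero    = f 0
(f ÷ g) (suc n) = ((λ i → f (suc i) ℤ.- f 0 ℤ.* g (suc i)) ÷ g) n

÷-* : ∀ f g → g 0 ≡ 1ℤ → (f ÷ g) * g ≈ f
÷-* f g g₀ zero = begin
  f 0 ℤ.* g 0 ℤ.+ 0ℤ  ≡⟨ ℤₚ.+-identityʳ _ ⟩
  f 0 ℤ.* g 0         ≡⟨ cong (f 0 ℤ.*_) g₀ ⟩
  f 0 ℤ.* 1ℤ          ≡⟨ ℤₚ.*-identityʳ _ ⟩
  f 0                 ∎
  where open ≡-Reasoning
÷-* f g g₀ (suc n) = begin
  x ℤ.+ ((f′ ÷ g) * g) n   ≡⟨ cong (λ y → x ℤ.+ y) (÷-* f′ g g₀ n) ⟩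
  x ℤ.+ (f (suc n) ℤ.- x)  ≡⟨ ℤₚ.+-assoc x (f (suc n)) (ℤ.- x) ⟨
  x ℤ.+ f (suc n) ℤ.- x    ≡⟨ xyx⁻¹≈y x (f (suc n)) ⟩
  f (suc n)                ∎
  where
  open ≡-Reasoning
  x = f 0 ℤ.* g (suc n)
  f′ : Series
  f′ i = f (suc i) ℤ.- f 0 ℤ.* g (suc i)

+-0#-rawMonoid : RawMonoid 0ℓ 0ℓ
+-0#-rawMonoid = record { Carrier = Series ; _≈_ = _≈_ ; _∙_ = _+_ ; ε = 0# }

-- ∑< n f = f 0 + ⋯ + f (n - 1)
∑< : ℕ → (ℕ → Series) → Series
∑< n f = sum {n} λ i → f (toℕ i)
  where open RawMonoidDefs +-0#-rawMonoid using (sum)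

-- Σ_{k ≥ 0} f k = s, for a family with only finitely many nonzero terms.
∑≥0_≈_ : (ℕ → Series) → Series → Set
∑≥0 f ≈ s = ∃[ K ] (∀ k → K ℕ.≤ k → f k ≈ 0#) × (∑< K f ≈ s)

[q]_ : ℕ → Series
[q] zero  = 1#
[q] suc m = [q] m * (1# - q^ suc m)

[q]-const : ∀ m → ([q] m) 0 ≡ 1ℤ
[q]-const zero    = refl
[q]-const (suc m) = cong (λ c → c ℤ.* 1ℤ ℤ.+ 0ℤ) ([q]-const m)

[q]*[q]-const : ∀ m n → ([q] m * [q] n) 0 ≡ 1ℤ
[q]*[q]-const m n =
  cong₂ (λ c d → c ℤ.* d ℤ.+ 0ℤ) ([q]-const m) ([q]-const n)

-- The q-binomial coefficient with upper entry m + n and lower entry m, as a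
-- function of m and n.
qbinom⁺ : ℤ → ℤ → Series
qbinom⁺ (+ m)    (+ n)    = [q] (m ℕ.+ n) ÷ ([q] m * [q] n)
qbinom⁺ (+ _)    -[1+ _ ] = 0#
qbinom⁺ -[1+ _ ] _        = 0#

qbinom : (A B : ℤ) → Series
qbinom A B = qbinom⁺ B (A ℤ.- B)

qtrinom : (L m k : ℤ) → Series
qtrinom L m k = qbinom L m * qbinom (L ℤ.- m) k

-- j (j + 1) is even and nonnegative for every integer j, so neither the
-- division nor the absolute value loses anything.
T : ℤ → ℕ
T j = ∣ (j ℤ.* (j ℤ.+ 1ℤ)) /ℕ 2 ∣

C : (L k : ℕ) → Series
C L k = ∑< (suc L) λ m →
  q^ (T (+ m) ℕ.+ T (+ (m ℕ.+ k))) * qtrinom (+ L) (+ m) (+ k)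

{-# OPTIONS --safe #-}
module Submission where

-- Expand C_{L,k} and put k = d + 2j, where d = a or d = a + 1 according to the
-- parity of k - a.  With n = m + j the product of the three q-binomials becomes
-- q^{T(n)+T(n+d)} [L; n] q^{j(j+d)} [n; j] [L-n; d+j], so the q-Vandermonde sum
-- over j leaves Σ_n q^{T(n)+T(n+d)} [L; n] [L; n+d].  The Pascal rule merges the
-- sums for d = a and d = a + 1 into q^{T(a)} Σ_n q^{n(n+a+1)} [L; n] [L+1; n+a+1],
-- which is q-Vandermonde again.  Negative a are reduced to a ≥ 0 by a ↦ - 1 - a,
-- under which both sides are invariant.

open import Algebra.Bundles using (CommutativeRing)
open import Algebra.Consequences.Setoid using (comm∧distrʳ⇒distr; comm∧idˡ⇒id)
import Algebra.Construct.Pointwise as Pointwise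
open import Algebra.Structures using (IsAbelianGroup)
open import Data.Fin using (toℕ)
open import Data.Fin.Properties using (toℕ<n)
open import Data.Integer as ℤ using (ℤ; +_; -[1+_]; 0ℤ; 1ℤ; ∣_∣; _⊖_; _/ℕ_)
import Data.Integer.DivMod as ℤ/
import Data.Integer.Properties as ℤₚ
import Data.Integer.Tactic.RingSolver as ℤ-Solver
open import Data.Nat as ℕ using (ℕ; zero; suc; _∸_; _≤_; _<_; s≤s)
open import Data.Nat.Divisibility using (divides-refl)
import Data.Nat.DivMod as ℕ/
import Data.Nat.Properties as ℕₚ
open import Data.Nat.Tactic.RingSolver using (solve-∀)
open import Data.Product using (_,_; ∃-syntax)
open import Data.Sum using (inj₁; inj₂)
open import Function using (_∘_)
open import Level using (0ℓ; _⊔_)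
open import Relation.Binary.PropositionalEquality as ≡ using (_≡_)

-- Triangular numbers

tri : ℕ → ℕ
tri zero    = 0
tri (suc n) = suc n ℕ.+ tri n

tri-+ : ∀ m n → tri (m ℕ.+ n) ≡ tri m ℕ.+ tri n ℕ.+ m ℕ.* n
tri-+ zero    n = ≡.sym (ℕₚ.+-identityʳ (tri n))
tri-+ (suc m) n = ≡.trans (≡.cong (suc (m ℕ.+ n) ℕ.+_) (tri-+ m n))
                          (lemma m n (tri m) (tri n))
  where
  lemma : ∀ m n s t → suc (m ℕ.+ n) ℕ.+ (s ℕ.+ t ℕ.+ m ℕ.* n)
                    ≡ suc m ℕ.+ s ℕ.+ t ℕ.+ suc m ℕ.* n
  lemma = solve-∀

tri-double : ∀ n → tri n ℕ.+ tri n ≡ n ℕ.* suc n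
tri-double zero    = ≡.refl
tri-double (suc n) = ≡.trans (regroup n (tri n))
  (≡.trans (≡.cong (λ x → suc n ℕ.+ suc n ℕ.+ x) (tri-double n)) (expand n))
  where
  regroup : ∀ n t → suc n ℕ.+ t ℕ.+ (suc n ℕ.+ t) ≡ suc n ℕ.+ suc n ℕ.+ (t ℕ.+ t)
  regroup = solve-∀
  expand : ∀ n → suc n ℕ.+ suc n ℕ.+ n ℕ.* suc n ≡ suc n ℕ.* suc (suc n)
  expand = solve-∀

-- q-binomials over a commutative ring

-- The ring is kept abstract: over concrete series, equality unfolds to
-- coefficients and implicit arguments can no longer be inferred.
record QFactorials {r₁ r₂} (R : CommutativeRing r₁ r₂) : Set (r₁ ⊔ r₂) where
  open CommutativeRing R
  field
    q^_        : ℕ → Carrier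
    q^-zero    : q^ 0 ≈ 1#
    q^-+       : ∀ m n → q^ (m ℕ.+ n) ≈ q^ m * q^ n
    [q]_       : ℕ → Carrier
    [q]-zero   : [q] 0 ≈ 1#
    [q]-suc    : ∀ m → [q] suc m ≈ [q] m * (1# - q^ suc m)
    [q]-cancel : ∀ m {x y} → x * [q] m ≈ y * [q] m → x ≈ y

module QBinomial {r₁ r₂} {R : CommutativeRing r₁ r₂} (Q : QFactorials R) where

  open CommutativeRing R
  open QFactorials Q
  open import Algebra.Properties.Semiring.Sum semiring
  open import Algebra.Properties.Ring ring using (-‿distribʳ-*)
  open import Algebra.Solver.Ring.NaturalCoefficients.Default commutativeSemiring
    using (solve; _:+_; _:*_; _:=_)
  open import Relation.Binary.Reasoning.Setoid setoid

  -- Finite sums over initial segments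

  ∑< : ℕ → (ℕ → Carrier) → Carrier
  ∑< n f = sum {n} λ i → f (toℕ i)

  ∑<-cong : ∀ n {f g} → (∀ i → i < n → f i ≈ g i) → ∑< n f ≈ ∑< n g
  ∑<-cong n f≈g = sum-cong-≋ {n} λ i → f≈g (toℕ i) (toℕ<n i)

  ∑<-zero : ∀ n {f} → (∀ i → i < n → f i ≈ 0#) → ∑< n f ≈ 0#
  ∑<-zero n f≈0 = trans (∑<-cong n f≈0) (sum-replicate-zero n)

  ∑<-++ : ∀ m n f → ∑< (m ℕ.+ n) f ≈ ∑< m f + ∑< n (λ i → f (m ℕ.+ i))
  ∑<-++ zero    n f = sym (+-identityˡ _)
  ∑<-++ (suc m) n f = trans (+-congˡ (∑<-++ m n (f ∘ suc))) (sym (+-assoc _ _ _))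

  ∑<-extend : ∀ m n f → (∀ i → m ≤ i → f i ≈ 0#) → ∑< (m ℕ.+ n) f ≈ ∑< m f
  ∑<-extend m n f f≈0 = begin
    ∑< (m ℕ.+ n) f                      ≈⟨ ∑<-++ m n f ⟩
    ∑< m f + ∑< n (λ i → f (m ℕ.+ i))   ≈⟨ +-congˡ (∑<-zero n λ i _ → f≈0 _ (ℕₚ.m≤m+n m i)) ⟩
    ∑< m f + 0#                         ≈⟨ +-identityʳ _ ⟩
    ∑< m f                              ∎

  ∑<-drop : ∀ m n f → (∀ i → i < m → f i ≈ 0#) →
            ∑< (m ℕ.+ n) f ≈ ∑< n (λ i → f (m ℕ.+ i))
  ∑<-drop m n f f≈0 = begin
    ∑< (m ℕ.+ n) f                      ≈⟨ ∑<-++ m n f ⟩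
    ∑< m f + ∑< n (λ i → f (m ℕ.+ i))   ≈⟨ +-congʳ (∑<-zero m f≈0) ⟩
    0# + ∑< n (λ i → f (m ℕ.+ i))       ≈⟨ +-identityˡ _ ⟩
    ∑< n (λ i → f (m ℕ.+ i))            ∎

  -- Both sides equal the sum of the first `m + n` terms. When `f` is supported between `m` and
  -- `n - 1`, a translated summation index may keep its range.
  ∑<-shift : ∀ m n f → (∀ i → i < m → f i ≈ 0#) → (∀ i → n ≤ i → f i ≈ 0#) →
             ∑< n (λ i → f (m ℕ.+ i)) ≈ ∑< n f
  ∑<-shift m n f low high = begin
    ∑< n (λ i → f (m ℕ.+ i))  ≈⟨ ∑<-drop m n f low ⟨
    ∑< (m ℕ.+ n) f            ≡⟨ ≡.cong (λ k → ∑< k f) (ℕₚ.+-comm m n) ⟩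
    ∑< (n ℕ.+ m) f            ≈⟨ ∑<-extend n m f high ⟩
    ∑< n f                    ∎

  ∑<-pairs : ∀ n f → ∑< (n ℕ.* 2) f
                   ≈ ∑< n (λ j → f (j ℕ.* 2)) + ∑< n (λ j → f (suc (j ℕ.* 2)))
  ∑<-pairs zero    f = sym (+-identityˡ 0#)
  ∑<-pairs (suc n) f = trans
    (+-congˡ (+-congˡ (∑<-pairs n (f ∘ suc ∘ suc))))
    (solve 4 (λ a b x y → a :+ (b :+ (x :+ y)) := (a :+ x) :+ (b :+ y)) refl _ _ _ _)

  -- q-binomials by the Pascal rule, and q-Vandermonde

  binom : ℕ → ℕ → Carrier
  binom _       zero    = 1#
  binom zero    (suc k) = 0#
  binom (suc n) (suc k) = binom n k + q^ suc k * binom n (suc k)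

  binom-zero : ∀ {n k} → n < k → binom n k ≈ 0#
  binom-zero {zero}  (s≤s _)   = refl
  binom-zero {suc n} (s≤s n<k) = begin
    _ + _ * _     ≈⟨ +-cong (binom-zero n<k) (*-congˡ (binom-zero (ℕₚ.m<n⇒m<1+n n<k))) ⟩
    0# + _ * 0#   ≈⟨ +-identityˡ _ ⟩
    _ * 0#        ≈⟨ zeroʳ _ ⟩
    0#            ∎

  q^-split : ∀ {k} m n → k ≡ m ℕ.+ n → q^ k ≈ q^ m * q^ n
  q^-split m n ≡.refl = q^-+ m n

  -- The Pascal rule is applied to the first factor and, read backwards, to the
  -- second one, so that (n + 1, p, d) is reduced to (n, p + 1, d + 1).
  vandermonde : ∀ n p d N → n < N →
    ∑< N (λ j → q^ (j ℕ.* (j ℕ.+ d)) * (binom n j * binom p (d ℕ.+ j)))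
      ≈ binom (n ℕ.+ p) (n ℕ.+ d)
  vandermonde zero p d (suc N) _ = begin
    q^ 0 * (1# * binom p (d ℕ.+ 0)) + ∑< N rest
      ≈⟨ +-cong (*-cong q^-zero (*-identityˡ _))
                (∑<-zero N {rest} λ j _ → trans (*-congˡ (zeroˡ _)) (zeroʳ _)) ⟩
    1# * binom p (d ℕ.+ 0) + 0#
      ≈⟨ trans (+-identityʳ _) (*-identityˡ _) ⟩
    binom p (d ℕ.+ 0)
      ≡⟨ ≡.cong (binom p) (ℕₚ.+-identityʳ d) ⟩
    binom p d ∎
    where
    rest : ℕ → Carrier
    rest j = q^ (suc j ℕ.* (suc j ℕ.+ d)) * (0# * binom p (d ℕ.+ suc j))
  vandermonde (suc n) p d (suc N) (s≤s n<N) = begin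
    t 0 + ∑< N (λ j → q^ (suc j ℕ.* (suc j ℕ.+ d)) *
                        (binom (suc n) (suc j) * binom p (d ℕ.+ suc j)))
      -- Pascal sends the part of `binom (suc n) (suc j)` weighted by `q^ suc j` to `t (suc j)` and
      -- the rest to `u j`. The term at 0 is `t 0` already, since `binom _ 0` is `1#` in every row.
      ≈⟨ +-congˡ (∑<-cong N λ j _ → split j) ⟩
    t 0 + ∑< N (λ j → t (suc j) + u j)
      ≈⟨ +-congˡ (∑-distrib-+ {N} _ _) ⟩
    t 0 + (∑< N (t ∘ suc) + ∑< N u)
      ≈⟨ +-assoc _ _ _ ⟨
    ∑< (suc N) t + ∑< N u
      ≡⟨ ≡.cong (λ k → ∑< k t + ∑< N u) (ℕₚ.+-comm 1 N) ⟩
    ∑< (N ℕ.+ 1) t + ∑< N u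
      -- The surplus term `t N` vanishes because `n < N`.
      ≈⟨ +-congʳ (∑<-extend N 1 t t-zero) ⟩
    ∑< N t + ∑< N u
      ≈⟨ ∑-distrib-+ {N} _ _ ⟨
    ∑< N (λ j → t j + u j)
      ≈⟨ ∑<-cong N (λ j _ → join j) ⟩
    ∑< N (λ j → q^ (j ℕ.* (j ℕ.+ suc d)) * (binom n j * binom (suc p) (suc d ℕ.+ j)))
      ≈⟨ vandermonde n (suc p) (suc d) N n<N ⟩
    binom (n ℕ.+ suc p) (n ℕ.+ suc d)
      ≡⟨ ≡.cong₂ binom (ℕₚ.+-suc n p) (ℕₚ.+-suc n d) ⟩
    binom (suc n ℕ.+ p) (suc n ℕ.+ d) ∎
    where
    t u : ℕ → Carrier
    t j = q^ (j ℕ.* (j ℕ.+ suc d)) * (binom n j * binom p (d ℕ.+ j))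
    u j = q^ (j ℕ.* (j ℕ.+ suc d)) *
            (binom n j * (q^ suc (d ℕ.+ j) * binom p (suc (d ℕ.+ j))))

    t-zero : ∀ j → N ≤ j → t j ≈ 0#
    t-zero j N≤j = trans
      (*-congˡ (trans (*-congʳ (binom-zero (ℕₚ.≤-trans n<N N≤j))) (zeroˡ _))) (zeroʳ _)

    join : ∀ j → t j + u j ≈
      q^ (j ℕ.* (j ℕ.+ suc d)) * (binom n j * binom (suc p) (suc d ℕ.+ j))
    join j = solve 5 (λ x b g r h → x :* (b :* g) :+ x :* (b :* (r :* h))
                                 := x :* (b :* (g :+ r :* h))) refl _ _ _ _ _

    exponent₁ : ∀ j d → suc j ℕ.* (suc j ℕ.+ suc d) ≡ suc j ℕ.* (suc j ℕ.+ d) ℕ.+ suc j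
    exponent₁ = solve-∀

    exponent₂ : ∀ j d → suc j ℕ.* (suc j ℕ.+ d) ≡ j ℕ.* (j ℕ.+ suc d) ℕ.+ suc (d ℕ.+ j)
    exponent₂ = solve-∀

    split : ∀ j → q^ (suc j ℕ.* (suc j ℕ.+ d)) *
                    (binom (suc n) (suc j) * binom p (d ℕ.+ suc j))
                  ≈ t (suc j) + u j
    split j = begin
      x * ((b + y * b′) * g)
        ≈⟨ solve 5 (λ x b y b′ g → x :* ((b :+ y :* b′) :* g)
                     := (x :* y) :* (b′ :* g) :+ x :* (b :* g)) refl x b y b′ g ⟩
      (x * y) * (b′ * g) + x * (b * g)
        ≈⟨ +-cong (*-congʳ (sym (q^-split _ _ (exponent₁ j d))))
                  (*-congʳ (q^-split _ _ (exponent₂ j d))) ⟩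
      t (suc j) + (q^ (j ℕ.* (j ℕ.+ suc d)) * q^ suc (d ℕ.+ j)) * (b * g)
        ≈⟨ +-congˡ (solve 4 (λ x r b g → (x :* r) :* (b :* g) := x :* (b :* (r :* g)))
                      refl _ _ b g) ⟩
      t (suc j) + q^ (j ℕ.* (j ℕ.+ suc d)) * (b * (q^ suc (d ℕ.+ j) * g))
        ≡⟨ ≡.cong (λ k → t (suc j) + q^ (j ℕ.* (j ℕ.+ suc d)) *
                           (b * (q^ suc (d ℕ.+ j) * binom p k))) (ℕₚ.+-suc d j) ⟩
      t (suc j) + u j ∎
      where
      x = q^ (suc j ℕ.* (suc j ℕ.+ d))
      y = q^ suc j
      b = binom n j
      b′ = binom n (suc j)
      g = binom p (d ℕ.+ suc j)

  -- Factorial form of the q-binomials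

  1-q^-+ : ∀ m n → (1# - q^ m) + q^ m * (1# - q^ n) ≈ 1# - q^ (m ℕ.+ n)
  1-q^-+ m n = begin
    (1# - x) + x * (1# - y)        ≈⟨ +-congˡ (distribˡ x 1# (- y)) ⟩
    (1# - x) + (x * 1# + x * - y)  ≈⟨ +-congˡ (+-cong (*-identityʳ x) (sym (-‿distribʳ-* x y))) ⟩
    (1# - x) + (x - x * y)         ≈⟨ solve 4 (λ o x′ x z → (o :+ x′) :+ (x :+ z) := (o :+ (x′ :+ x)) :+ z) refl 1# (- x) x (- (x * y)) ⟩
    (1# + (- x + x)) - x * y       ≈⟨ +-congʳ (trans (+-congˡ (-‿inverseˡ x)) (+-identityʳ 1#)) ⟩
    1# - x * y                     ≈⟨ +-congˡ (-‿cong (q^-+ m n)) ⟨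
    1# - q^ (m ℕ.+ n)              ∎
    where
    x = q^ m
    y = q^ n

  -- Ties the Pascal recursion to the factorial quotient, with denominators cleared because the
  -- abstract ring has no division. In the inductive step both hypotheses produce the factor
  -- `[q] (m + suc n)`, and `1-q^-+` adds up the two weights that remain.
  binom-[q] : ∀ m n → binom (m ℕ.+ n) m * ([q] m * [q] n) ≈ [q] (m ℕ.+ n)
  binom-[q] zero n = begin
    1# * ([q] 0 * [q] n)  ≈⟨ *-identityˡ _ ⟩
    [q] 0 * [q] n         ≈⟨ *-congʳ [q]-zero ⟩
    1# * [q] n            ≈⟨ *-identityˡ _ ⟩
    [q] n                 ∎
  binom-[q] (suc m) zero = begin
    (b + _ * binom (m ℕ.+ 0) (suc m)) * ([q] suc m * [q] 0)
      ≈⟨ *-cong (trans (+-congˡ (trans (*-congˡ (binom-zero (ℕ.s≤s (ℕₚ.≤-reflexive (ℕₚ.+-identityʳ m))))) (zeroʳ _))) (+-identityʳ b))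
                (*-congʳ ([q]-suc m)) ⟩
    b * (([q] m * (1# - q^ suc m)) * [q] 0)
      ≈⟨ solve 4 (λ b m s z → b :* ((m :* s) :* z) := (b :* (m :* z)) :* s) refl b _ _ _ ⟩
    (b * ([q] m * [q] 0)) * (1# - q^ suc m)
      ≈⟨ *-congʳ (binom-[q] m 0) ⟩
    [q] (m ℕ.+ 0) * (1# - q^ suc m)
      ≡⟨ ≡.cong (λ k → [q] (m ℕ.+ 0) * (1# - q^ suc k)) (≡.sym (ℕₚ.+-identityʳ m)) ⟩
    [q] (m ℕ.+ 0) * (1# - q^ suc (m ℕ.+ 0))
      ≈⟨ [q]-suc _ ⟨
    [q] (suc m ℕ.+ 0) ∎
    where b = binom (m ℕ.+ 0) m
  binom-[q] (suc m) (suc n) = begin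
    (b + q^ suc m * b′) * ([q] suc m * [q] suc n)
      ≈⟨ solve 5 (λ b r b′ s t → (b :+ r :* b′) :* (s :* t)
                   := b :* (s :* t) :+ r :* (b′ :* (s :* t))) refl b _ b′ _ _ ⟩
    b * ([q] suc m * [q] suc n) + q^ suc m * (b′ * ([q] suc m * [q] suc n))
      ≈⟨ +-cong (*-congˡ (*-congʳ ([q]-suc m)))
                (*-congˡ (*-congˡ (*-congˡ ([q]-suc n)))) ⟩
    b * (([q] m * (1# - q^ suc m)) * [q] suc n)
      + q^ suc m * (b′ * ([q] suc m * ([q] n * (1# - q^ suc n))))
      ≈⟨ +-cong
           (solve 4 (λ b m s z → b :* ((m :* s) :* z) := (b :* (m :* z)) :* s) refl b _ _ _)
           (solve 5 (λ r b m n s → r :* (b :* (m :* (n :* s))) := (b :* (m :* n)) :* (r :* s))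
              refl _ b′ _ _ _) ⟩
    (b * ([q] m * [q] suc n)) * (1# - q^ suc m)
      + (b′ * ([q] suc m * [q] n)) * (q^ suc m * (1# - q^ suc n))
      ≈⟨ +-cong (*-congʳ (binom-[q] m (suc n)))
                (*-congʳ (trans (*-congʳ (reflexive (≡.cong (λ k → binom k (suc m)) (ℕₚ.+-suc m n))))
                         (trans (binom-[q] (suc m) n) (reflexive (≡.cong [q]_ (≡.sym (ℕₚ.+-suc m n))))))) ⟩
    [q] (m ℕ.+ suc n) * (1# - q^ suc m)
      + [q] (m ℕ.+ suc n) * (q^ suc m * (1# - q^ suc n))
      ≈⟨ distribˡ _ _ _ ⟨
    [q] (m ℕ.+ suc n) * ((1# - q^ suc m) + q^ suc m * (1# - q^ suc n))
      ≈⟨ *-congˡ (1-q^-+ (suc m) (suc n)) ⟩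
    [q] (m ℕ.+ suc n) * (1# - q^ suc (m ℕ.+ suc n))
      ≈⟨ [q]-suc _ ⟨
    [q] (suc m ℕ.+ suc n) ∎
    where
    b = binom (m ℕ.+ suc n) m
    b′ = binom (m ℕ.+ suc n) (suc m)

  [q]*[q]-cancel : ∀ m n {x y} → x * ([q] m * [q] n) ≈ y * ([q] m * [q] n) → x ≈ y
  [q]*[q]-cancel m n eq =
    [q]-cancel m ([q]-cancel n (trans (*-assoc _ _ _) (trans eq (sym (*-assoc _ _ _)))))

  binom-unique : ∀ m n {x} → x * ([q] m * [q] n) ≈ [q] (m ℕ.+ n) → x ≈ binom (m ℕ.+ n) m
  binom-unique m n x-[q] = [q]*[q]-cancel m n (trans x-[q] (sym (binom-[q] m n)))

  binom-sym : ∀ m n → binom (m ℕ.+ n) n ≈ binom (m ℕ.+ n) m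
  binom-sym m n = binom-unique m n (begin
    binom (m ℕ.+ n) n * ([q] m * [q] n)  ≈⟨ *-congˡ (*-comm _ _) ⟩
    binom (m ℕ.+ n) n * ([q] n * [q] m)  ≡⟨ ≡.cong (λ k → binom k n * ([q] n * [q] m)) (ℕₚ.+-comm m n) ⟩
    binom (n ℕ.+ m) n * ([q] n * [q] m)  ≈⟨ binom-[q] n m ⟩
    [q] (n ℕ.+ m)                        ≡⟨ ≡.cong [q]_ (ℕₚ.+-comm n m) ⟩
    [q] (m ℕ.+ n)                        ∎)

  -- Both sides are (q)_{m+n+p} / ((q)_m (q)_n (q)_p): multiply by the three factorials, then cancel
  -- them.
  trinomial-revision : ∀ m n p →
    binom (m ℕ.+ (n ℕ.+ p)) m * binom (n ℕ.+ p) n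
      ≈ binom (m ℕ.+ (n ℕ.+ p)) (m ℕ.+ n) * binom (m ℕ.+ n) m
  trinomial-revision m n p = [q]*[q]-cancel m n ([q]-cancel p (begin
    ((a * b) * ([q] m * [q] n)) * [q] p
      ≈⟨ solve 5 (λ a b m n p → ((a :* b) :* (m :* n)) :* p
                   := a :* (m :* (b :* (n :* p)))) refl a b _ _ _ ⟩
    a * ([q] m * (b * ([q] n * [q] p)))
      ≈⟨ *-congˡ (*-congˡ (binom-[q] n p)) ⟩
    a * ([q] m * [q] (n ℕ.+ p))
      ≈⟨ binom-[q] m (n ℕ.+ p) ⟩
    [q] (m ℕ.+ (n ℕ.+ p))
      ≡⟨ ≡.cong [q]_ (ℕₚ.+-assoc m n p) ⟨
    [q] (m ℕ.+ n ℕ.+ p)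
      ≈⟨ binom-[q] (m ℕ.+ n) p ⟨
    binom (m ℕ.+ n ℕ.+ p) (m ℕ.+ n) * ([q] (m ℕ.+ n) * [q] p)
      ≡⟨ ≡.cong (λ k → binom k (m ℕ.+ n) * ([q] (m ℕ.+ n) * [q] p)) (ℕₚ.+-assoc m n p) ⟩
    c * ([q] (m ℕ.+ n) * [q] p)
      ≈⟨ *-congˡ (*-congʳ (binom-[q] m n)) ⟨
    c * ((d * ([q] m * [q] n)) * [q] p)
      ≈⟨ solve 4 (λ c d x p → c :* ((d :* x) :* p) := ((c :* d) :* x) :* p) refl c d _ _ ⟩
    ((c * d) * ([q] m * [q] n)) * [q] p ∎))
    where
    a = binom (m ℕ.+ (n ℕ.+ p)) m
    b = binom (n ℕ.+ p) n
    c = binom (m ℕ.+ (n ℕ.+ p)) (m ℕ.+ n)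
    d = binom (m ℕ.+ n) m

  *-zeroʳ-cong : ∀ {x y} → y ≈ 0# → x * y ≈ 0#
  *-zeroʳ-cong y≈0 = trans (*-congˡ y≈0) (zeroʳ _)

  *-zeroˡ-cong : ∀ {x y} → x ≈ 0# → x * y ≈ 0#
  *-zeroˡ-cong x≈0 = trans (*-congʳ x≈0) (zeroˡ _)

  -- If j + k ≤ s, both sides are the q-multinomial with parts m, j, k and s - j - k, and two
  -- trinomial revisions connect them. Otherwise both sides vanish.
  quadrinomial-revision : ∀ m s j k →
    binom (m ℕ.+ s) m * (binom s (j ℕ.+ k) * binom (j ℕ.+ k) j)
      ≈ binom (m ℕ.+ s) (m ℕ.+ j) * (binom (m ℕ.+ j) j * binom (s ∸ j) k)
  quadrinomial-revision m s j k with ℕₚ.≤-<-connex j s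
  -- Here `s ∸ j` is truncated to 0, which is harmless because `binom (m + s) (m + j)` vanishes.
  ... | inj₂ s<j = trans
    (*-zeroʳ-cong (*-zeroˡ-cong (binom-zero (ℕₚ.m≤n⇒m≤n+o k s<j))))
    (sym (*-zeroˡ-cong (binom-zero (ℕₚ.+-monoʳ-< m s<j))))
  ... | inj₁ j≤s with ℕₚ.m≤n⇒∃[o]m+o≡n j≤s
  ... | t , ≡.refl rewrite ℕₚ.m+n∸m≡n j t with ℕₚ.≤-<-connex k t
  ... | inj₂ t<k = trans
    (*-zeroʳ-cong (*-zeroˡ-cong (binom-zero (ℕₚ.+-monoʳ-< j t<k))))
    (sym (*-zeroʳ-cong (*-zeroʳ-cong (binom-zero t<k))))
  ... | inj₁ k≤t with ℕₚ.m≤n⇒∃[o]m+o≡n k≤t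
  ... | r , ≡.refl = begin
    a * (binom (j ℕ.+ (k ℕ.+ r)) (j ℕ.+ k) * binom (j ℕ.+ k) j)
      ≈⟨ *-congˡ (trinomial-revision j k r) ⟨
    a * (binom (j ℕ.+ (k ℕ.+ r)) j * b)
      ≈⟨ *-assoc _ _ _ ⟨
    (a * binom (j ℕ.+ (k ℕ.+ r)) j) * b
      ≈⟨ *-congʳ (trinomial-revision m j (k ℕ.+ r)) ⟩
    (c * binom (m ℕ.+ j) m) * b
      ≈⟨ *-assoc _ _ _ ⟩
    c * (binom (m ℕ.+ j) m * b)
      ≈⟨ *-congˡ (*-congʳ (binom-sym m j)) ⟨
    c * (binom (m ℕ.+ j) j * b) ∎
    where
    a = binom (m ℕ.+ (j ℕ.+ (k ℕ.+ r))) m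
    b = binom (k ℕ.+ r) k
    c = binom (m ℕ.+ (j ℕ.+ (k ℕ.+ r))) (m ℕ.+ j)

  -- The sum over k

  coeff : ℕ → ℕ → Carrier
  coeff L k = ∑< (suc L) λ m → q^ (tri m ℕ.+ tri (m ℕ.+ k)) * (binom L m * binom (L ∸ m) k)

  coeff-zero : ∀ {L k} → L < k → coeff L k ≈ 0#
  coeff-zero {L} {k} L<k = ∑<-zero (suc L)
    {λ m → q^ (tri m ℕ.+ tri (m ℕ.+ k)) * (binom L m * binom (L ∸ m) k)}
    λ m _ → *-zeroʳ-cong (*-zeroʳ-cong (binom-zero (ℕₚ.≤-<-trans (ℕₚ.m∸n≤m L m) L<k)))

  -- Handles the k of one parity class. In the variables n = m + j and j the two ranges become
  -- independent, so the sums can be exchanged, and the inner sum over j is an instance of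
  -- q-Vandermonde.
  ∑-coeff-binom : ∀ L d →
    ∑< (suc L) (λ j → coeff L (d ℕ.+ j ℕ.* 2) * binom (d ℕ.+ j ℕ.* 2) j)
      ≈ ∑< (suc L) (λ n → q^ (tri n ℕ.+ tri (n ℕ.+ d)) * (binom L n * binom L (n ℕ.+ d)))
  ∑-coeff-binom L d = begin
    ∑< N (λ j → coeff L (d ℕ.+ j ℕ.* 2) * binom (d ℕ.+ j ℕ.* 2) j)
      ≈⟨ ∑<-cong N (λ j _ → *-distribʳ-sum {N} (binom (d ℕ.+ j ℕ.* 2) j)
           (λ m → q^ (tri (toℕ m) ℕ.+ tri (toℕ m ℕ.+ (d ℕ.+ j ℕ.* 2))) *
                  (binom L (toℕ m) * binom (L ∸ toℕ m) (d ℕ.+ j ℕ.* 2)))) ⟩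
    ∑< N (λ j → ∑< N λ m → summand m j)
      ≈⟨ ∑<-cong N (λ j _ → ∑<-cong N λ m m<N → reindex j m (ℕ.s≤s⁻¹ m<N)) ⟩
    ∑< N (λ j → ∑< N λ m → h (j ℕ.+ m) j)
      -- [n; j] vanishes for n < j and [L; n] for n > L, so n may run from 0 to L whatever j is.
      ≈⟨ ∑<-cong N (λ j _ → ∑<-shift j N (λ n → h n j) (low j) (high j)) ⟩
    ∑< N (λ j → ∑< N λ n → h n j)
      ≈⟨ ∑-comm {N} {N} (λ j n → h (toℕ n) (toℕ j)) ⟩
    ∑< N (λ n → ∑< N λ j → h n j)
      ≈⟨ ∑<-cong N (λ n n<N → collapse n n<N) ⟩
    ∑< N (λ n → q^ (tri n ℕ.+ tri (n ℕ.+ d)) * (binom L n * binom L (n ℕ.+ d))) ∎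
    where
    N = suc L

    summand : ℕ → ℕ → Carrier
    summand m j = q^ (tri m ℕ.+ tri (m ℕ.+ (d ℕ.+ j ℕ.* 2))) *
      (binom L m * binom (L ∸ m) (d ℕ.+ j ℕ.* 2)) * binom (d ℕ.+ j ℕ.* 2) j

    v : ℕ → ℕ → Carrier
    v n j = q^ (j ℕ.* (j ℕ.+ d)) * (binom n j * binom (L ∸ n) (d ℕ.+ j))

    h : ℕ → ℕ → Carrier
    h n j = (q^ (tri n ℕ.+ tri (n ℕ.+ d)) * binom L n) * v n j

    low : ∀ j n → n < j → h n j ≈ 0#
    low j n n<j = *-zeroʳ-cong (*-zeroʳ-cong (*-zeroˡ-cong (binom-zero n<j)))

    high : ∀ j n → N ≤ n → h n j ≈ 0#
    high j n L<n = *-zeroˡ-cong (*-zeroʳ-cong (binom-zero L<n))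

    double : ∀ j → j ℕ.* 2 ≡ j ℕ.+ j
    double = solve-∀

    -- The surplus j (j + d) over T(n) + T(n + d) at n = j + m is exactly the exponent in
    -- q-Vandermonde.
    exponent : ∀ m j → tri m ℕ.+ tri (m ℕ.+ (d ℕ.+ j ℕ.* 2))
      ≡ (tri (j ℕ.+ m) ℕ.+ tri (j ℕ.+ m ℕ.+ d)) ℕ.+ j ℕ.* (j ℕ.+ d)
    exponent m j
      rewrite tri-+ m (d ℕ.+ j ℕ.* 2) | tri-+ d (j ℕ.* 2)
            | ≡.trans (≡.cong tri (double j)) (tri-+ j j)
            | tri-+ (j ℕ.+ m) d | tri-+ j m
      = lemma m j d (tri m) (tri j) (tri d)
      where
      lemma : ∀ m j d s t u →
        s ℕ.+ (s ℕ.+ (u ℕ.+ (t ℕ.+ t ℕ.+ j ℕ.* j) ℕ.+ d ℕ.* (j ℕ.* 2)) ℕ.+ m ℕ.* (d ℕ.+ j ℕ.* 2))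
          ≡ t ℕ.+ s ℕ.+ j ℕ.* m ℕ.+ (t ℕ.+ s ℕ.+ j ℕ.* m ℕ.+ u ℕ.+ (j ℕ.+ m) ℕ.* d) ℕ.+ j ℕ.* (j ℕ.+ d)
      lemma = solve-∀

    lower : ∀ d j → d ℕ.+ j ℕ.* 2 ≡ j ℕ.+ (d ℕ.+ j)
    lower = solve-∀

    revision : ∀ m j → m ≤ L →
      binom L m * (binom (L ∸ m) (d ℕ.+ j ℕ.* 2) * binom (d ℕ.+ j ℕ.* 2) j)
        ≈ binom L (j ℕ.+ m) * (binom (j ℕ.+ m) j * binom (L ∸ (j ℕ.+ m)) (d ℕ.+ j))
    revision m j m≤L with ℕₚ.m≤n⇒∃[o]m+o≡n m≤L
    ... | s , ≡.refl
      rewrite ℕₚ.+-comm j m | ℕₚ.[m+n]∸[m+o]≡n∸o m s j | ℕₚ.m+n∸m≡n m s | lower d j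
      = quadrinomial-revision m s j (d ℕ.+ j)

    reindex : ∀ j m → m ≤ L → summand m j ≈ h (j ℕ.+ m) j
    reindex j m m≤L = begin
      x * (a * b) * c
        ≈⟨ solve 4 (λ x a b c → x :* (a :* b) :* c := x :* (a :* (b :* c))) refl x a b c ⟩
      x * (a * (b * c))
        ≈⟨ *-cong (q^-split _ _ (exponent m j)) (revision m j m≤L) ⟩
      (y * z) * (a′ * (b′ * c′))
        ≈⟨ solve 5 (λ y z a b c → (y :* z) :* (a :* (b :* c)) := (y :* a) :* (z :* (b :* c)))
             refl y z a′ b′ c′ ⟩
      (y * a′) * (z * (b′ * c′)) ∎
      where
      x = q^ (tri m ℕ.+ tri (m ℕ.+ (d ℕ.+ j ℕ.* 2)))
      y = q^ (tri (j ℕ.+ m) ℕ.+ tri (j ℕ.+ m ℕ.+ d))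
      z = q^ (j ℕ.* (j ℕ.+ d))
      a = binom L m
      b = binom (L ∸ m) (d ℕ.+ j ℕ.* 2)
      c = binom (d ℕ.+ j ℕ.* 2) j
      a′ = binom L (j ℕ.+ m)
      b′ = binom (j ℕ.+ m) j
      c′ = binom (L ∸ (j ℕ.+ m)) (d ℕ.+ j)

    collapse : ∀ n → n < N → ∑< N (h n)
      ≈ q^ (tri n ℕ.+ tri (n ℕ.+ d)) * (binom L n * binom L (n ℕ.+ d))
    collapse n n<N = begin
      ∑< N (h n)
        ≈⟨ *-distribˡ-sum {N} x (λ j → v n (toℕ j)) ⟨
      x * ∑< N (v n)
        ≈⟨ *-congˡ (vandermonde n (L ∸ n) d N n<N) ⟩
      x * binom (n ℕ.+ (L ∸ n)) (n ℕ.+ d)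
        ≡⟨ ≡.cong (λ k → x * binom k (n ℕ.+ d)) (ℕₚ.m+[n∸m]≡n (ℕ.s≤s⁻¹ n<N)) ⟩
      x * binom L (n ℕ.+ d)
        ≈⟨ *-assoc _ _ _ ⟩
      q^ (tri n ℕ.+ tri (n ℕ.+ d)) * (binom L n * binom L (n ℕ.+ d)) ∎
      where x = q^ (tri n ℕ.+ tri (n ℕ.+ d)) * binom L n

  -- Keeping `f` arbitrary separates the algebra from the floors: the summand matters only below `a`
  -- and on the two parity classes from `a` on. The range holds `suc L` pairs after the first `a`
  -- terms, so each class gets the range of `∑-coeff-binom`.
  ∑-coeff : ∀ L a (f : ℕ → Carrier) →
    (∀ k → k < a → f k ≈ 0#) →
    (∀ j → f (a ℕ.+ j ℕ.* 2) ≈ coeff L (a ℕ.+ j ℕ.* 2) * binom (a ℕ.+ j ℕ.* 2) j) →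
    (∀ j → f (suc a ℕ.+ j ℕ.* 2) ≈ coeff L (suc a ℕ.+ j ℕ.* 2) * binom (suc a ℕ.+ j ℕ.* 2) j) →
    ∑< (a ℕ.+ suc L ℕ.* 2) f ≈ q^ tri a * binom (L ℕ.+ suc L) (L ℕ.+ suc a)
  ∑-coeff L a f below even odd = begin
    ∑< (a ℕ.+ N ℕ.* 2) f
      ≈⟨ ∑<-drop a (N ℕ.* 2) f below ⟩
    ∑< (N ℕ.* 2) (λ i → f (a ℕ.+ i))
      ≈⟨ ∑<-pairs N (λ i → f (a ℕ.+ i)) ⟩
    ∑< N (λ j → f (a ℕ.+ j ℕ.* 2)) + ∑< N (λ j → f (a ℕ.+ suc (j ℕ.* 2)))
      ≈⟨ +-cong (∑<-cong N λ j _ → even j)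
                (∑<-cong N λ j _ → trans (reflexive (≡.cong f (ℕₚ.+-suc a (j ℕ.* 2)))) (odd j)) ⟩
    ∑< N (λ j → coeff L (a ℕ.+ j ℕ.* 2) * binom (a ℕ.+ j ℕ.* 2) j)
      + ∑< N (λ j → coeff L (suc a ℕ.+ j ℕ.* 2) * binom (suc a ℕ.+ j ℕ.* 2) j)
      ≈⟨ +-cong (∑-coeff-binom L a) (∑-coeff-binom L (suc a)) ⟩
    ∑< N (p a) + ∑< N (p (suc a))
      ≈⟨ ∑-distrib-+ {N} (p a ∘ toℕ) (p (suc a) ∘ toℕ) ⟨
    ∑< N (λ n → p a n + p (suc a) n)
      ≈⟨ ∑<-cong N (λ n _ → pascal n) ⟩
    ∑< N (λ n → q^ tri a * w n)
      ≈⟨ *-distribˡ-sum {N} (q^ tri a) (λ n → w (toℕ n)) ⟨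
    q^ tri a * ∑< N w
      ≈⟨ *-congˡ (vandermonde L (suc L) (suc a) N (ℕₚ.n<1+n L)) ⟩
    q^ tri a * binom (L ℕ.+ suc L) (L ℕ.+ suc a) ∎
    where
    N = suc L

    p : ℕ → ℕ → Carrier
    p d n = q^ (tri n ℕ.+ tri (n ℕ.+ d)) * (binom L n * binom L (n ℕ.+ d))

    w : ℕ → Carrier
    w n = q^ (n ℕ.* (n ℕ.+ suc a)) * (binom L n * binom (suc L) (suc a ℕ.+ n))

    exponent₁ : ∀ n → tri n ℕ.+ tri (n ℕ.+ a) ≡ tri a ℕ.+ n ℕ.* (n ℕ.+ suc a)
    exponent₁ n rewrite tri-+ n a = ≡.trans (regroup n a (tri n) (tri a))
      (≡.trans (≡.cong (λ x → tri a ℕ.+ (x ℕ.+ n ℕ.* a)) (tri-double n)) (expand n a (tri a)))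
      where
      regroup : ∀ n a s t → s ℕ.+ (s ℕ.+ t ℕ.+ n ℕ.* a) ≡ t ℕ.+ (s ℕ.+ s ℕ.+ n ℕ.* a)
      regroup = solve-∀
      expand : ∀ n a t → t ℕ.+ (n ℕ.* suc n ℕ.+ n ℕ.* a) ≡ t ℕ.+ n ℕ.* (n ℕ.+ suc a)
      expand = solve-∀

    -- The excess over `exponent₁` is a + n + 1, the weight of [L; a + n + 1] in the Pascal rule for
    -- [L + 1; a + n + 1]. This is what lets the two parity classes merge.
    exponent₂ : ∀ n → tri n ℕ.+ tri (n ℕ.+ suc a)
                    ≡ (tri a ℕ.+ n ℕ.* (n ℕ.+ suc a)) ℕ.+ suc (a ℕ.+ n)
    exponent₂ n = ≡.trans (≡.cong (λ k → tri n ℕ.+ tri k) (ℕₚ.+-suc n a))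
      (≡.trans (regroup n a (tri n) (tri (n ℕ.+ a)))
               (≡.cong (ℕ._+ suc (a ℕ.+ n)) (exponent₁ n)))
      where
      regroup : ∀ n a s t → s ℕ.+ (suc (n ℕ.+ a) ℕ.+ t) ≡ s ℕ.+ t ℕ.+ suc (a ℕ.+ n)
      regroup = solve-∀

    pascal : ∀ n → p a n + p (suc a) n ≈ q^ tri a * w n
    pascal n = begin
      p a n + p (suc a) n
        ≡⟨ ≡.cong₂ (λ i j → q^ (tri n ℕ.+ tri (n ℕ.+ a)) * (b * binom L i)
                            + q^ (tri n ℕ.+ tri (n ℕ.+ suc a)) * (b * binom L j))
             (ℕₚ.+-comm n a) (ℕₚ.+-comm n (suc a)) ⟩
      q^ (tri n ℕ.+ tri (n ℕ.+ a)) * (b * g) + q^ (tri n ℕ.+ tri (n ℕ.+ suc a)) * (b * g′)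
        ≈⟨ +-cong (*-congʳ (q^-split _ _ (exponent₁ n)))
                  (*-congʳ (trans (q^-split _ _ (exponent₂ n)) (*-congʳ (q^-+ (tri a) _)))) ⟩
      (x * y) * (b * g) + ((x * y) * r) * (b * g′)
        ≈⟨ solve 6 (λ x y b g r g′ → (x :* y) :* (b :* g) :+ ((x :* y) :* r) :* (b :* g′)
                      := x :* (y :* (b :* (g :+ r :* g′)))) refl x y b g r g′ ⟩
      x * (y * (b * (g + r * g′))) ∎
      where
      x = q^ tri a
      y = q^ (n ℕ.* (n ℕ.+ suc a))
      r = q^ suc (a ℕ.+ n)
      b = binom L n
      g = binom L (a ℕ.+ n)
      g′ = binom L (suc (a ℕ.+ n))

-- The ring of formal power series

open import Defs
open import Relation.Binary.PropositionalEquality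
  using (refl; sym; trans; cong; cong₂; subst; module ≡-Reasoning)

-- Induction on the coefficient index works because (f * g) (suc n) unfolds to
-- f 0 ℤ.* g (suc n) ℤ.+ ((f ∘ suc) * g) n.
*-cong : ∀ {f f′ g g′} → f ≈ f′ → g ≈ g′ → f * g ≈ f′ * g′
*-cong f≈ g≈ zero    = cong₂ (λ x y → x ℤ.* y ℤ.+ 0ℤ) (f≈ 0) (g≈ 0)
*-cong f≈ g≈ (suc n) = cong₂ ℤ._+_ (cong₂ ℤ._*_ (f≈ 0) (g≈ (suc n))) (*-cong (f≈ ∘ suc) g≈ n)

-- Needed for associativity, where shifting `f * g` by one index leaves a summand that is `g ∘ suc`
-- scaled by `f 0`.
scale-* : ∀ c f g → (λ i → c ℤ.* f i) * g ≈ (λ i → c ℤ.* (f * g) i)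
scale-* c f g zero    = lemma c (f 0) (g 0)
  where
  lemma : ∀ c x y → c ℤ.* x ℤ.* y ℤ.+ 0ℤ ≡ c ℤ.* (x ℤ.* y ℤ.+ 0ℤ)
  lemma = ℤ-Solver.solve-∀
scale-* c f g (suc n) = trans (cong (λ y → c ℤ.* f 0 ℤ.* g (suc n) ℤ.+ y) (scale-* c (f ∘ suc) g n))
  (lemma c (f 0) (g (suc n)) _)
  where
  lemma : ∀ c x y z → c ℤ.* x ℤ.* y ℤ.+ c ℤ.* z ≡ c ℤ.* (x ℤ.* y ℤ.+ z)
  lemma = ℤ-Solver.solve-∀

*-distribʳ-+ : ∀ h f g → (f + g) * h ≈ f * h + g * h
*-distribʳ-+ h f g zero    = lemma (h 0) (f 0) (g 0)
  where
  lemma : ∀ h f g → (f ℤ.+ g) ℤ.* h ℤ.+ 0ℤ ≡ (f ℤ.* h ℤ.+ 0ℤ) ℤ.+ (g ℤ.* h ℤ.+ 0ℤ)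
  lemma = ℤ-Solver.solve-∀
*-distribʳ-+ h f g (suc n) =
  trans (cong (λ y → (f 0 ℤ.+ g 0) ℤ.* h (suc n) ℤ.+ y) (*-distribʳ-+ h (f ∘ suc) (g ∘ suc) n))
        (lemma (h (suc n)) (f 0) (g 0) _ _)
  where
  lemma : ∀ h f g x y → (f ℤ.+ g) ℤ.* h ℤ.+ (x ℤ.+ y) ≡ (f ℤ.* h ℤ.+ x) ℤ.+ (g ℤ.* h ℤ.+ y)
  lemma = ℤ-Solver.solve-∀

*-comm : ∀ f g → f * g ≈ g * f
*-comm f g zero = cong (ℤ._+ 0ℤ) (ℤₚ.*-comm (f 0) (g 0))
*-comm f g (suc zero) = lemma (f 0) (g 1) (f 1) (g 0)
  where
  lemma : ∀ a b c d → a ℤ.* b ℤ.+ (c ℤ.* d ℤ.+ 0ℤ) ≡ d ℤ.* c ℤ.+ (b ℤ.* a ℤ.+ 0ℤ)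
  lemma = ℤ-Solver.solve-∀
-- Unfolding once in each factor brings out the two end terms and leaves a product at index `n`.
-- This lowers the index by two, hence the separate case of index 1.
*-comm f g (suc (suc n)) = begin
  x ℤ.+ ((f ∘ suc) * g) (suc n)             ≡⟨ cong (λ z → x ℤ.+ z) (*-comm (f ∘ suc) g (suc n)) ⟩
  x ℤ.+ (y ℤ.+ ((g ∘ suc) * (f ∘ suc)) n)   ≡⟨ cong (λ z → x ℤ.+ (y ℤ.+ z)) (*-comm (g ∘ suc) (f ∘ suc) n) ⟩
  x ℤ.+ (y ℤ.+ ((f ∘ suc) * (g ∘ suc)) n)   ≡⟨ swap x y _ ⟩
  y ℤ.+ (x ℤ.+ ((f ∘ suc) * (g ∘ suc)) n)   ≡⟨ cong (λ z → y ℤ.+ z) (*-comm (g ∘ suc) f (suc n)) ⟨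
  y ℤ.+ ((g ∘ suc) * f) (suc n)             ∎
  where
  open ≡-Reasoning
  x = f 0 ℤ.* g (suc (suc n))
  y = g 0 ℤ.* f (suc (suc n))
  swap : ∀ x y z → x ℤ.+ (y ℤ.+ z) ≡ y ℤ.+ (x ℤ.+ z)
  swap = ℤ-Solver.solve-∀

*-assoc : ∀ f g h → (f * g) * h ≈ f * (g * h)
*-assoc f g h zero = lemma (f 0) (g 0) (h 0)
  where
  lemma : ∀ f g h → (f ℤ.* g ℤ.+ 0ℤ) ℤ.* h ℤ.+ 0ℤ ≡ f ℤ.* (g ℤ.* h ℤ.+ 0ℤ) ℤ.+ 0ℤ
  lemma = ℤ-Solver.solve-∀
*-assoc f g h (suc n) = begin
  (f 0 ℤ.* g 0 ℤ.+ 0ℤ) ℤ.* h (suc n) ℤ.+ (((λ i → f 0 ℤ.* g (suc i)) + (f ∘ suc) * g) * h) n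
    ≡⟨ cong (λ z → x ℤ.+ z) (*-distribʳ-+ h (λ i → f 0 ℤ.* g (suc i)) ((f ∘ suc) * g) n) ⟩
  x ℤ.+ (((λ i → f 0 ℤ.* g (suc i)) * h) n ℤ.+ ((f ∘ suc) * g * h) n)
    ≡⟨ cong₂ (λ y z → x ℤ.+ (y ℤ.+ z)) (scale-* (f 0) (g ∘ suc) h n) (*-assoc (f ∘ suc) g h n) ⟩
  x ℤ.+ (f 0 ℤ.* ((g ∘ suc) * h) n ℤ.+ ((f ∘ suc) * (g * h)) n)
    ≡⟨ lemma (f 0) (g 0) (h (suc n)) _ _ ⟩
  f 0 ℤ.* (g 0 ℤ.* h (suc n) ℤ.+ ((g ∘ suc) * h) n) ℤ.+ ((f ∘ suc) * (g * h)) n ∎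
  where
  open ≡-Reasoning
  x = (f 0 ℤ.* g 0 ℤ.+ 0ℤ) ℤ.* h (suc n)
  lemma : ∀ f g h y z → (f ℤ.* g ℤ.+ 0ℤ) ℤ.* h ℤ.+ (f ℤ.* y ℤ.+ z) ≡ f ℤ.* (g ℤ.* h ℤ.+ y) ℤ.+ z
  lemma = ℤ-Solver.solve-∀

*-zeroˡ : ∀ f → 0# * f ≈ 0#
*-zeroˡ f zero    = refl
*-zeroˡ f (suc n) = trans (ℤₚ.+-identityˡ _) (*-zeroˡ f n)

*-identityˡ : ∀ f → 1# * f ≈ f
*-identityˡ f zero    = trans (ℤₚ.+-identityʳ _) (ℤₚ.*-identityˡ (f 0))
*-identityˡ f (suc n) = begin
  1ℤ ℤ.* f (suc n) ℤ.+ (0# * f) n  ≡⟨ cong₂ ℤ._+_ (ℤₚ.*-identityˡ (f (suc n))) (*-zeroˡ f n) ⟩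
  f (suc n) ℤ.+ 0ℤ                 ≡⟨ ℤₚ.+-identityʳ _ ⟩
  f (suc n)                        ∎
  where open ≡-Reasoning

ℤ⟦q⟧ : CommutativeRing 0ℓ 0ℓ
ℤ⟦q⟧ = record
  { _≈_ = _≈_ ; _+_ = _+_ ; _*_ = _*_ ; -_ = λ f i → ℤ.- f i ; 0# = 0# ; 1# = 1#
  ; isCommutativeRing = record
    { isRing = record
      { +-isAbelianGroup = +-isAbelianGroup
      ; *-cong = *-cong
      ; *-assoc = *-assoc
      ; *-identity = comm∧idˡ⇒id setoid *-comm *-identityˡ
      ; distrib = comm∧distrʳ⇒distr setoid ∙-cong *-comm *-distribʳ-+
      }
    ; *-comm = *-comm
    }
  }
  where
  +-isAbelianGroup = Pointwise.isAbelianGroup ℕ ℤₚ.+-0-isAbelianGroup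
  open IsAbelianGroup +-isAbelianGroup using (setoid; ∙-cong)

-- Powers of q and uniqueness of quotients

q^-zero : q^ 0 ≈ 1#
q^-zero zero    = refl
q^-zero (suc _) = refl

q^-+ : ∀ m n → q^ (m ℕ.+ n) ≈ q^ m * q^ n
q^-+ zero    n i       = sym (trans (*-cong {q^ 0} {1#} {q^ n} q^-zero (λ _ → refl) i) (*-identityˡ (q^ n) i))
q^-+ (suc m) n zero    = refl
q^-+ (suc m) n (suc i) = trans (q^-+ m n i) (sym (ℤₚ.+-identityˡ _))

-- The constant coefficient forces `x 0 ≡ f 0`. The tail of `x` then solves the same equation for
-- the remainder after one step of long division.
÷-unique : ∀ {f g x} → g 0 ≡ 1ℤ → x * g ≈ f → x ≈ f ÷ g
÷-unique {f} {g} {x} g₀ x*g zero = begin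
  x 0                  ≡⟨ ℤₚ.*-identityʳ (x 0) ⟨
  x 0 ℤ.* 1ℤ           ≡⟨ cong (x 0 ℤ.*_) g₀ ⟨
  x 0 ℤ.* g 0          ≡⟨ ℤₚ.+-identityʳ _ ⟨
  x 0 ℤ.* g 0 ℤ.+ 0ℤ   ≡⟨ x*g 0 ⟩
  f 0                  ∎
  where open ≡-Reasoning
÷-unique {f} {g} {x} g₀ x*g (suc n) = ÷-unique {x = x ∘ suc} g₀ x*g′ n
  where
  cancel : ∀ a b → b ≡ a ℤ.+ b ℤ.- a
  cancel = ℤ-Solver.solve-∀
  x*g′ : (x ∘ suc) * g ≈ λ i → f (suc i) ℤ.- f 0 ℤ.* g (suc i)
  x*g′ i = trans (cancel (x 0 ℤ.* g (suc i)) _)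
    (cong₂ (λ y c → y ℤ.- c ℤ.* g (suc i)) (x*g (suc i)) (÷-unique {f} {g} {x} g₀ x*g zero))

-- Both `x` and `y` are the quotient of `y * g` by `g`. It applies to (q)_m, whose constant
-- coefficient is 1.
*-cancelʳ : ∀ {g x y} → g 0 ≡ 1ℤ → x * g ≈ y * g → x ≈ y
*-cancelʳ {g} {x} {y} g₀ eq n =
  trans (÷-unique {y * g} {g} {x} g₀ eq n) (sym (÷-unique {y * g} {g} {y} g₀ (λ _ → refl) n))

open CommutativeRing ℤ⟦q⟧ using ()
  renaming (refl to ≈-refl; sym to ≈-sym; trans to ≈-trans; reflexive to ≈-reflexive)

q-factorials : QFactorials ℤ⟦q⟧
q-factorials = record
  { q^_ = q^_
  ; q^-zero = q^-zero
  ; q^-+ = q^-+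
  ; [q]_ = [q]_
  ; [q]-zero = ≈-refl
  ; [q]-suc = λ _ → ≈-refl
  ; [q]-cancel = λ m → *-cancelʳ ([q]-const m)
  }

open QBinomial q-factorials hiding (∑<)

-- Integer entries of q-binomials

m⊖1+m+n : ∀ m n → m ⊖ suc (m ℕ.+ n) ≡ -[1+ n ]
m⊖1+m+n zero    n = refl
m⊖1+m+n (suc m) n = trans (ℤₚ.[1+m]⊖[1+n]≡m⊖n m (suc (m ℕ.+ n))) (m⊖1+m+n m n)

m+n-m : ∀ m n → + (m ℕ.+ n) ℤ.- + m ≡ + n
m+n-m m n = trans (ℤₚ.m-n≡m⊖n (m ℕ.+ n) m)
  (trans (ℤₚ.⊖-≥ (ℕₚ.m≤m+n m n)) (cong +_ (ℕₚ.m+n∸m≡n m n)))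

-- For k ≤ n the quotient satisfies the cleared equation that determines `binom`. For k > n the
-- difference n - k is negative, which selects the zero clause of `qbinom⁺`.
qbinom-binom : ∀ n k → qbinom (+ n) (+ k) ≈ binom n k
qbinom-binom n k with ℕₚ.≤-<-connex k n
... | inj₁ k≤n with ℕₚ.m≤n⇒∃[o]m+o≡n k≤n
... | r , refl = ≈-trans (≈-reflexive (cong (qbinom⁺ (+ k)) (m+n-m k r)))
  (binom-unique k r (÷-* ([q] (k ℕ.+ r)) ([q] k * [q] r) ([q]*[q]-const k r)))
qbinom-binom n k | inj₂ n<k with ℕₚ.m≤n⇒∃[o]m+o≡n n<k
... | i , refl = ≈-trans (≈-reflexive (cong (qbinom⁺ (+ k)) (m⊖1+m+n n i)))
  (≈-sym (binom-zero n<k))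

-- Triangular numbers and floors at integer arguments

n*[1+n]/2≡tri : ∀ n → (n ℕ.* suc n) ℕ./ 2 ≡ tri n
n*[1+n]/2≡tri n = begin
  (n ℕ.* suc n) ℕ./ 2        ≡⟨ cong (ℕ._/ 2) (tri-double n) ⟨
  (tri n ℕ.+ tri n) ℕ./ 2    ≡⟨ cong (ℕ._/ 2) (lemma (tri n)) ⟩
  (tri n ℕ.* 2) ℕ./ 2        ≡⟨ ℕ/.m*n/n≡m (tri n) 2 ⟩
  tri n                      ∎
  where
  open ≡-Reasoning
  lemma : ∀ t → t ℕ.+ t ≡ t ℕ.* 2
  lemma = solve-∀

T-tri : ∀ n → T (+ n) ≡ tri n
T-tri n = begin
  ∣ (+ n ℤ.* + (n ℕ.+ 1)) /ℕ 2 ∣  ≡⟨ cong (λ x → ∣ x /ℕ 2 ∣) (ℤₚ.pos-* n (n ℕ.+ 1)) ⟨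
  (n ℕ.* (n ℕ.+ 1)) ℕ./ 2         ≡⟨ cong (λ k → (n ℕ.* k) ℕ./ 2) (ℕₚ.+-comm n 1) ⟩
  (n ℕ.* suc n) ℕ./ 2             ≡⟨ n*[1+n]/2≡tri n ⟩
  tri n                           ∎
  where open ≡-Reasoning

T-neg : ∀ n → T -[1+ n ] ≡ tri n
T-neg zero    = refl
T-neg (suc n) = trans (cong (ℕ._/ 2) (ℕₚ.*-comm (suc (suc n)) (suc n))) (n*[1+n]/2≡tri (suc n))

C-coeff : ∀ L k → C L k ≈ coeff L k
C-coeff L k = ∑<-cong (suc L)
  {λ m → q^ (T (+ m) ℕ.+ T (+ (m ℕ.+ k))) * qtrinom (+ L) (+ m) (+ k)}
  {λ m → q^ (tri m ℕ.+ tri (m ℕ.+ k)) * (binom L m * binom (L ∸ m) k)}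
  λ m m<1+L → *-cong
    (≈-reflexive (cong q^_ (cong₂ ℕ._+_ (T-tri m) (T-tri (m ℕ.+ k)))))
    (*-cong (qbinom-binom L m)
      (≈-trans (≈-reflexive (cong (λ x → qbinom x (+ k)) (minus m (ℕ.s≤s⁻¹ m<1+L))))
               (qbinom-binom (L ∸ m) k)))
  where
  minus : ∀ m → m ≤ L → + L ℤ.- + m ≡ + (L ∸ m)
  minus m m≤L = trans (ℤₚ.m-n≡m⊖n L m) (ℤₚ.⊖-≥ m≤L)

-- The division rounds down, so a negative numerator cannot give 0: a quotient m ≥ 0 would force 2m
-- ≤ -1 - n.
-[1+n]/2 : ∀ n → ∃[ m ] -[1+ n ] /ℕ 2 ≡ -[1+ m ]
-[1+n]/2 n with -[1+ n ] /ℕ 2 | ℤ/.[n/ℕd]*d≤n -[1+ n ] 2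
... | -[1+ m ] | _ = m , refl
... | + m      | m*2≤ with subst (ℤ._≤ -[1+ n ]) (sym (ℤₚ.pos-* m 2)) m*2≤
... | ()

1+n*2/2 : ∀ n → suc (n ℕ.* 2) ℕ./ 2 ≡ n
1+n*2/2 n = trans (ℕ/.+-distrib-/-∣ʳ 1 {n ℕ.* 2} {2} (divides-refl n)) (ℕ/.m*n/n≡m n 2)

qbinom-above : ∀ {n k} → n < k → qbinom (+ n) (+ k) ≈ 0#
qbinom-above {n} {k} n<k = ≈-trans (qbinom-binom n k) (binom-zero n<k)

-- Reduction to a nonnegative parameter

floor : ℕ → ℤ → ℤ
floor k a = (+ k ℤ.- a) /ℕ 2

-- By the symmetry of the q-binomials, all that the identity needs to know
-- about a is the same for a = b and for a = - 1 - b.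
record _ReducesTo_ (a : ℤ) (b : ℕ) : Set where
  field
    below : ∀ k → k < b → qbinom (+ k) (floor k a) ≈ 0#
    even  : ∀ j → qbinom (+ (b ℕ.+ j ℕ.* 2)) (floor (b ℕ.+ j ℕ.* 2) a) ≈ binom (b ℕ.+ j ℕ.* 2) j
    odd   : ∀ j → qbinom (+ (suc b ℕ.+ j ℕ.* 2)) (floor (suc b ℕ.+ j ℕ.* 2) a)
                  ≈ binom (suc b ℕ.+ j ℕ.* 2) j
    T≡tri : T a ≡ tri b
    right : ∀ L → qbinom (+ (2 ℕ.* L ℕ.+ 1)) (+ L ℤ.- a) ≈ binom (L ℕ.+ suc L) (L ℕ.+ suc b)

qbinom-≡-binom : ∀ n k {x} → x ≡ + k → qbinom (+ n) x ≈ binom n k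
qbinom-≡-binom n k refl = qbinom-binom n k

2*L+1 : ∀ L → 2 ℕ.* L ℕ.+ 1 ≡ L ℕ.+ suc L
2*L+1 = solve-∀

-- Here k - b is 2j or 2j + 1, so the floor is j itself. Symmetry enters only in `right`, where L -
-- b and L + b + 1 are complementary in 2L + 1.
reduces⁺ : ∀ b → (+ b) ReducesTo b
reduces⁺ b = record
  { below = below
  ; even = λ j → qbinom-≡-binom _ j (trans (cong (_/ℕ 2) (m+n-m b (j ℕ.* 2))) (cong +_ (ℕ/.m*n/n≡m j 2)))
  ; odd = λ j → qbinom-≡-binom _ j (trans
      (cong (_/ℕ 2) (trans (cong (λ k → + k ℤ.- + b) (sym (ℕₚ.+-suc b (j ℕ.* 2)))) (m+n-m b (suc (j ℕ.* 2)))))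
      (cong +_ (1+n*2/2 j)))
  ; T≡tri = T-tri b
  ; right = right
  }
  where
  below : ∀ k → k < b → qbinom (+ k) (floor k (+ b)) ≈ 0#
  -- The numerator k - b is negative, and so is the lower entry.
  below k k<b with ℕₚ.m≤n⇒∃[o]m+o≡n k<b
  ... | i , refl with -[1+n]/2 i
  ... | m , eq = ≈-reflexive (cong (qbinom (+ k)) (trans (cong (_/ℕ 2) (m⊖1+m+n k i)) eq))

  right : ∀ L → qbinom (+ (2 ℕ.* L ℕ.+ 1)) (+ L ℤ.- + b) ≈ binom (L ℕ.+ suc L) (L ℕ.+ suc b)
  right L rewrite 2*L+1 L with ℕₚ.≤-<-connex b L
  ... | inj₁ b≤L with ℕₚ.m≤n⇒∃[o]m+o≡n b≤L
  ... | c , refl = ≈-trans (qbinom-≡-binom _ c (m+n-m b c))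
    (≈-trans (≈-reflexive (cong (λ n → binom n c) (lemma b c)))
    (≈-trans (≈-sym (binom-sym c (b ℕ.+ c ℕ.+ suc b)))
             (≈-reflexive (cong (λ n → binom n (b ℕ.+ c ℕ.+ suc b)) (sym (lemma b c))))))
    where
    lemma : ∀ b c → b ℕ.+ c ℕ.+ suc (b ℕ.+ c) ≡ c ℕ.+ (b ℕ.+ c ℕ.+ suc b)
    lemma = solve-∀
  -- Both sides are zero: L - b is negative and L + b + 1 exceeds 2L + 1.
  right L | inj₂ L<b with ℕₚ.m≤n⇒∃[o]m+o≡n L<b
  ... | i , refl = ≈-trans (≈-reflexive (cong (qbinom (+ (L ℕ.+ suc L))) (m⊖1+m+n L i)))
    (≈-sym (binom-zero (ℕₚ.+-monoʳ-< L (ℕ.s≤s L<b))))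

-- Here the numerator is k + b + 1, and the floor is b + j or b + 1 + j, the complement of j in k.
-- Symmetry thus enters in `even` and `odd`, while `right` is immediate.
reduces⁻ : ∀ b → -[1+ b ] ReducesTo b
reduces⁻ b = record
  { below = below
  ; even = λ j → upper b j (trans (cong (ℕ._/ 2) (lemma₁ b j)) (1+n*2/2 (b ℕ.+ j)))
  ; odd = λ j → upper (suc b) j (trans (cong (ℕ._/ 2) (lemma₂ b j)) (ℕ/.m*n/n≡m (suc b ℕ.+ j) 2))
  ; T≡tri = T-neg b
  ; right = λ L → ≈-trans (≈-reflexive (cong (λ n → qbinom (+ n) (+ (L ℕ.+ suc b))) (2*L+1 L)))
                          (qbinom-binom (L ℕ.+ suc L) (L ℕ.+ suc b))
  }
  where
  lemma₁ : ∀ b j → b ℕ.+ j ℕ.* 2 ℕ.+ suc b ≡ suc ((b ℕ.+ j) ℕ.* 2)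
  lemma₁ = solve-∀
  lemma₂ : ∀ b j → suc b ℕ.+ j ℕ.* 2 ℕ.+ suc b ≡ (suc b ℕ.+ j) ℕ.* 2
  lemma₂ = solve-∀
  lemma₃ : ∀ b j → b ℕ.+ j ℕ.* 2 ≡ j ℕ.+ (b ℕ.+ j)
  lemma₃ = solve-∀
  lemma₄ : ∀ k i → k ℕ.+ suc (suc k ℕ.+ i) ≡ suc k ℕ.* 2 ℕ.+ i
  lemma₄ = solve-∀

  upper : ∀ c j {m} → m ≡ c ℕ.+ j →
          qbinom (+ (c ℕ.+ j ℕ.* 2)) (+ m) ≈ binom (c ℕ.+ j ℕ.* 2) j
  upper c j refl rewrite lemma₃ c j =
    ≈-trans (qbinom-binom (j ℕ.+ (c ℕ.+ j)) (c ℕ.+ j)) (binom-sym j (c ℕ.+ j))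

  below : ∀ k → k < b → qbinom (+ k) (floor k -[1+ b ]) ≈ 0#
  -- Unlike for a = b, the lower entry is now too large: k + b + 1 ≥ 2 (k + 1), so the floor exceeds
  -- k.
  below k k<b with ℕₚ.m≤n⇒∃[o]m+o≡n k<b
  ... | i , refl = qbinom-above (begin
    suc k                        ≡⟨ ℕ/.m*n/n≡m (suc k) 2 ⟨
    (suc k ℕ.* 2) ℕ./ 2          ≤⟨ ℕ/./-monoˡ-≤ 2 (ℕₚ.m≤m+n (suc k ℕ.* 2) i) ⟩
    (suc k ℕ.* 2 ℕ.+ i) ℕ./ 2    ≡⟨ cong (ℕ._/ 2) (lemma₄ k i) ⟨
    (k ℕ.+ suc b) ℕ./ 2          ∎)
    where open ℕₚ.≤-Reasoning

∑-C-qbinom : ∀ L {a b} → a ReducesTo b →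
  ∑≥0 (λ k → C L k * qbinom (+ k) ((+ k ℤ.- a) /ℕ 2))
    ≈ (q^ T a * qbinom (+ (2 ℕ.* L ℕ.+ 1)) (+ L ℤ.- a))
∑-C-qbinom L {a} {b} a⇝b =
    -- The bound is the range in `∑-coeff`. It exceeds L, and C_{L,k} vanishes for every k > L.
    b ℕ.+ suc L ℕ.* 2
  , (λ k K≤k → *-zeroˡ-cong {C L k} (≈-trans (C-coeff L k) (coeff-zero (ℕₚ.≤-trans L<K K≤k))))
  , ≈-trans
      (∑-coeff L b (λ k → C L k * qbinom (+ k) (floor k a))
        (λ k k<b → *-zeroʳ-cong {C L k} (below k k<b))
        (λ j → *-cong (C-coeff L (b ℕ.+ j ℕ.* 2)) (even j))
        (λ j → *-cong (C-coeff L (suc b ℕ.+ j ℕ.* 2)) (odd j)))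
      (*-cong (≈-reflexive (cong q^_ (sym T≡tri))) (≈-sym (right L)))
  where
  open _ReducesTo_ a⇝b
  L<K : L < b ℕ.+ suc L ℕ.* 2
  L<K = ℕₚ.≤-trans (ℕₚ.m≤m*n (suc L) 2) (ℕₚ.m≤n+m (suc L ℕ.* 2) b)

theorem2p1 : (L : ℕ) (a : ℤ) →
    ∑≥0 (λ k → C L k * qbinom (+ k) ((+ k ℤ.- a) /ℕ 2))
    ≈ (q^ T a * qbinom (+ (2 ℕ.* L ℕ.+ 1)) (+ L ℤ.- a))
theorem2p1 L (+ b)    = ∑-C-qbinom L (reduces⁺ b)
theorem2p1 L -[1+ b ] = ∑-C-qbinom L (reduces⁻ b)
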